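{- The mapping $\Delta$ is a bijection between covered maps and left-connected oriented maps.
   Context: Permutations are composed right to left. A (rooted) map is a triple $M=(H,\sigma,\alpha)$ with $H$ a finite set of half-edges, $\alpha$ a fixed-point-free involution, $\sigma$ a permutation, $\langle\sigma,\alpha\rangle$ transitive on $H$, and a root $r\in H$; maps are considered up to root-preserving relabelling. Cycles of $\sigma$, $\alpha$, $\phi=\sigma\alpha$ are vertices, edges, faces. For $S\subseteq H$ and a permutation $\pi$, $\pi_{|S}$ is the permutation of $S$ obtained by erasing elements not in $S$ from the cycles of $\pi$. A spanned map $(M,S)$ has $S\subseteq H$ stable by $\alpha$; it is a covered map if $(S,\sigma_{|S},\alpha_{|S})$ is a connecting unicellular map ($\sigma_{|S},\alpha_{|S}$ transitive on $S$, $S$ meets every cycle of $\sigma$ — except $S=\emptyset$ is allowed if $M$ has one vertex — and $\sigma_{|S}\alpha_{|S}$ is cyclic). Its motion function $\theta(h)=\sigma\alpha(h)$ for $h\in S$, $\theta(h)=\sigma(h)$ otherwise, is cyclic for covered maps, and the appearance order is $r\prec_S\theta(r)\prec_S\cdots\prec_S\theta^{|H|-1}(r)$. An oriented map is $(M,(I,O))$ with $H=I\uplus O$ and $\alpha(I)=O$. $\Delta(M,S)=(M,(I,O))$ with $I=\{h\in S:\alpha(h)\prec_S h\}\cup\{h\notin S:h\prec_S\alpha(h)\}$, $O=H\setminus I$. Let $h_0=r$ be the root. A left-path is a sequence $h_1,\dots,h_k$ of half-edges of $I$ such that for each $j=1,\dots,k$ there is an integer $q_j>0$ with $h_{j-1}=\sigma^{q_j}(\alpha(h_j))$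 and $\sigma^p(\alpha(h_j))\in O$ for all $p=0,\dots,q_j-1$. The oriented map is left-connected if every $h\in I$ is the last element $h_k$ of some left-path. -}

module Defs where

open import Data.Bool.Base using (if_then_else_)
open import Data.Fin.Base as Fin using (Fin)
open import Data.Fin.Permutation using (Permutation; Permutation′; _⟨$⟩ʳ_; _⟨$⟩ˡ_; inverseʳ; inverseˡ)
open import Data.Fin.Properties using (any?; _≟_; _<?_)
open import Data.Fin.Subset using (Subset; _∈_; _∉_; ∁; Empty)
open import Data.Fin.Subset.Properties using (_∈?_)
open import Data.Nat.Base using (ℕ; zero; suc; _<_)
open import Data.Product.Base using (Σ-syntax; ∃; ∃₂; ∃-syntax; _×_; _,_; proj₁; proj₂)
open import Data.Sum.Base using (_⊎_)
open import Data.Vec.Base using (tabulate)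
open import Function.Base using (_∘_; _on_)
open import Function.Bundles using (_⇔_; mk⇔; Equivalence)
open import Function.Construct.Composition using (_↔-∘_)
open import Function.Construct.Identity using (↔-id)
open import Function.Construct.Symmetry using (↔-sym)
open import Level using (0ℓ)
open import Relation.Binary.Bundles using (Setoid)
open import Relation.Binary.Construct.Closure.Equivalence using (EqClosure)
open import Relation.Binary.Construct.Closure.Transitive using (TransClosure)
open import Relation.Binary.Core using (Rel)
open import Relation.Binary.PropositionalEquality
open import Relation.Binary.Structures using (IsEquivalence)
open import Relation.Nullary using (does; ¬_; Dec)
open import Relation.Nullary.Decidable using (¬?; _×-dec_; _⊎-dec_)
import Relation.Binary.Construct.On as On
import Function.Endo.Propositional as Endo

open module Iterate {n : ℕ} = Endo (Fin n) using (_^_) public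

-- x and y lie in the same orbit of the group ⟨f,g⟩; the inverses of f and g
-- enter through the symmetric part of the closure.
SameOrbit : ∀ {n} → (f g : Fin n → Fin n) → Rel (Fin n) 0ℓ
SameOrbit f g = EqClosure (λ x y → f x ≡ y ⊎ g x ≡ y)

record RootedMap : Set where
  field
    size         : ℕ

  H : Set
  H = Fin size

  field
    σ-perm       : Permutation′ size
    α            : H → H
    α-involutive : ∀ h → α (α h) ≡ h
    α-noFixed    : ∀ h → α h ≢ h

  σ : H → H
  σ = σ-perm ⟨$⟩ʳ_

  field
    transitive   : ∀ x y → SameOrbit σ α x y
    root         : H

-- A rooted map together with a set of half-edges: the common carrier of
-- spanned maps (M,S) and of oriented maps (M,(I,O)), the latter being given
-- by I alone since O is its complement.
record MarkedMap : Set where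
  field
    map    : RootedMap
    marked : Subset (RootedMap.size map)
  open RootedMap map public

-- Root-preserving relabelling of half-edges.
record _≅_ (A B : MarkedMap) : Set where
  private
    module A = MarkedMap A
    module B = MarkedMap B
  field
    relabel     : Permutation A.size B.size
    σ-compat    : ∀ h → relabel ⟨$⟩ʳ A.σ h ≡ B.σ (relabel ⟨$⟩ʳ h)
    α-compat    : ∀ h → relabel ⟨$⟩ʳ A.α h ≡ B.α (relabel ⟨$⟩ʳ h)
    root-compat : relabel ⟨$⟩ʳ A.root ≡ B.root
    set-compat  : ∀ h → h ∈ A.marked ⇔ (relabel ⟨$⟩ʳ h) ∈ B.marked

≅-refl : ∀ {A} → A ≅ A
≅-refl = record
  { relabel     = ↔-id _
  ; σ-compat    = λ _ → refl
  ; α-compat    = λ _ → refl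
  ; root-compat = refl
  ; set-compat  = λ _ → mk⇔ (λ p → p) (λ p → p)
  }

≅-sym : ∀ {A B} → A ≅ B → B ≅ A
≅-sym {A} {B} i = record
  { relabel     = ↔-sym f
  ; σ-compat    = λ h → flipped A.σ B.σ σ-compat h
  ; α-compat    = λ h → flipped A.α B.α α-compat h
  ; root-compat = trans (cong (f ⟨$⟩ˡ_) (sym root-compat)) (inverseˡ f)
  ; set-compat  = λ h → mk⇔
      (λ p → Equivalence.from (set-compat _) (subst (_∈ B.marked) (sym (inverseʳ f)) p))
      (λ p → subst (_∈ B.marked) (inverseʳ f) (Equivalence.to (set-compat _) p))
  }
  where
  module A = MarkedMap A
  module B = MarkedMap B
  open _≅_ i renaming (relabel to f)
  flipped : (a : A.H → A.H) (b : B.H → B.H) →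
            (∀ h → f ⟨$⟩ʳ a h ≡ b (f ⟨$⟩ʳ h)) →
            ∀ h → f ⟨$⟩ˡ b h ≡ a (f ⟨$⟩ˡ h)
  flipped a b e h = begin
    f ⟨$⟩ˡ b h                       ≡⟨ cong (λ x → f ⟨$⟩ˡ b x) (inverseʳ f) ⟨
    f ⟨$⟩ˡ b (f ⟨$⟩ʳ (f ⟨$⟩ˡ h))     ≡⟨ cong (f ⟨$⟩ˡ_) (e (f ⟨$⟩ˡ h)) ⟨
    f ⟨$⟩ˡ (f ⟨$⟩ʳ a (f ⟨$⟩ˡ h))     ≡⟨ inverseˡ f ⟩
    a (f ⟨$⟩ˡ h)                     ∎
    where open ≡-Reasoning

≅-trans : ∀ {A B C} → A ≅ B → B ≅ C → A ≅ C
≅-trans i j = record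
  { relabel     = J.relabel ↔-∘ I.relabel
  ; σ-compat    = λ h → trans (cong (J.relabel ⟨$⟩ʳ_) (I.σ-compat h)) (J.σ-compat _)
  ; α-compat    = λ h → trans (cong (J.relabel ⟨$⟩ʳ_) (I.α-compat h)) (J.α-compat _)
  ; root-compat = trans (cong (J.relabel ⟨$⟩ʳ_) I.root-compat) J.root-compat
  ; set-compat  = λ h → mk⇔
      (Equivalence.to (J.set-compat _) ∘ Equivalence.to (I.set-compat h))
      (Equivalence.from (I.set-compat h) ∘ Equivalence.from (J.set-compat _))
  }
  where
  module I = _≅_ i
  module J = _≅_ j

≅-isEquivalence : IsEquivalence _≅_
≅-isEquivalence = record { refl = ≅-refl ; sym = ≅-sym ; trans = ≅-trans }

-- First point of S among x, π x, …, π^(k-1) x.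
firstIn : ∀ {n} → Subset n → (Fin n → Fin n) → ℕ → Fin n → Fin n
firstIn S π zero    x = x
firstIn S π (suc k) x = if does (x ∈? S) then x else firstIn S π k (π x)

-- The restriction of a permutation π to S, extended by the identity outside
-- S: for h ∈ S, the next element of S on the cycle of h.  The bound n
-- suffices because h itself is one of π h, …, π^n h.
_∣ᵣ_ : ∀ {n} → (Fin n → Fin n) → Subset n → Fin n → Fin n
_∣ᵣ_ {n} π S h = if does (h ∈? S) then firstIn S π n (π h) else h

module _ (A : MarkedMap) where
  open MarkedMap A renaming (marked to S)

  OneVertex : Set
  OneVertex = ∀ x y → ∃[ k ] (σ ^ k) x ≡ y

  record IsCovered : Set where
    field
      stable      : ∀ {h} → h ∈ S → α h ∈ S
      transitiveS : ∀ {x y} → x ∈ S → y ∈ S → SameOrbit (σ ∣ᵣ S) (α ∣ᵣ S) x y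
      connecting  : (∀ h → ∃[ k ] (σ ^ k) h ∈ S) ⊎ (Empty S × OneVertex)
      unicellular : ∀ {x y} → x ∈ S → y ∈ S →
                    ∃[ k ] (((σ ∣ᵣ S) ∘ (α ∣ᵣ S)) ^ k) x ≡ y

  θ : H → H
  θ h = if does (h ∈? S) then σ (α h) else σ h

  -- Appearance order.  It is a strict total order only when θ is cyclic.
  _≺_ : Rel H 0ℓ
  x ≺ y = ∃₂ λ (i j : Fin size) → i Fin.< j × (θ ^ Fin.toℕ i) root ≡ x × (θ ^ Fin.toℕ j) root ≡ y

  _≺?_ : ∀ x y → Dec (x ≺ y)
  x ≺? y = any? λ i → any? λ j → (i <? j) ×-dec (_ ≟ x) ×-dec (_ ≟ y)

  Incoming : H → Set
  Incoming h = (h ∈ S × α h ≺ h) ⊎ (h ∉ S × h ≺ α h)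

  incoming? : ∀ h → Dec (Incoming h)
  incoming? h = ((h ∈? S) ×-dec (α h ≺? h)) ⊎-dec (¬? (h ∈? S) ×-dec (h ≺? α h))

Δ : MarkedMap → MarkedMap
Δ A = record
  { map    = MarkedMap.map A
  ; marked = tabulate (λ h → does (incoming? A h))
  }

module _ (A : MarkedMap) where
  open MarkedMap A renaming (marked to I)

  O : Subset size
  O = ∁ I

  -- α(I) = O
  IsOriented : Set
  IsOriented = ∀ h → h ∈ O ⇔ (∃[ x ] x ∈ I × α x ≡ h)

  -- LeftStep h' h: h may follow h' on a left-path.
  LeftStep : Rel H 0ℓ
  LeftStep h' h = h ∈ I × ∃[ q ] (0 < q × h' ≡ (σ ^ q) (α h) ×
                                  (∀ p → p < q → (σ ^ p) (α h) ∈ O))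

  -- The closure ranges over chains root = h₀, h₁, …, h_k with k ≥ 1; the root
  -- itself need not be in I.
  EndsLeftPath : H → Set
  EndsLeftPath = TransClosure LeftStep root

  IsLeftConnected : Set
  IsLeftConnected = ∀ {h} → h ∈ I → EndsLeftPath h

  record IsLeftConnectedOriented : Set where
    field
      oriented      : IsOriented
      leftConnected : IsLeftConnected

CoveredMap : Setoid 0ℓ 0ℓ
CoveredMap = record
  { Carrier       = Σ[ A ∈ MarkedMap ] IsCovered A
  ; _≈_           = _≅_ on proj₁
  ; isEquivalence = On.isEquivalence proj₁ ≅-isEquivalence
  }

LeftConnectedOrientedMap : Setoid 0ℓ 0ℓ
LeftConnectedOrientedMap = record
  { Carrier       = Σ[ A ∈ MarkedMap ] IsLeftConnectedOriented A
  ; _≈_           = _≅_ on proj₁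
  ; isEquivalence = On.isEquivalence proj₁ ≅-isEquivalence
  }

{-# OPTIONS --safe #-}
-- A stable set S spans a covered map exactly when its motion function θ is
-- cyclic.  For cyclic θ, the first visited half-edge h of each edge satisfies
-- h ∈ S ⇔ h ∉ I, so S is recovered from I by following θ from the root.  In
-- Δ (M , S), turning from α h through half-edges of O only moves forward in the
-- appearance order until it wraps around to the root, which yields left-paths.
-- Conversely, when S is built by following θ on an oriented map, the set of
-- visited half-edges is closed under the steps of left-paths, so left-connectedness
-- makes θ cyclic.

module Submission where

open import Defs
open import Data.Fin.Base using (Fin; toℕ; fromℕ<)
open import Data.Fin.Permutation using (_⟨$⟩ʳ_; inverseˡ; ↔⇒≡)
open import Data.Fin.Properties using (_≟_; any?; pigeonhole; injective⇒≤; fromℕ<-injective; toℕ-fromℕ<; toℕ<n)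
open import Data.Fin.Subset using (Subset; _∈_; _∉_; Empty; ⊥)
open import Data.Fin.Subset.Properties using (∉⊥; _∈?_; x∈∁p⇒x∉p; x∉p⇒x∈∁p)
open import Data.Nat.Base hiding (_^_)
open import Data.Nat.DivMod
open import Data.Nat.Induction using (<-rec; <-wellFounded)
open import Data.Nat.Properties hiding (_≟_)
open import Induction.WellFounded using (Acc; acc)
open import Data.Product.Base using (Σ-syntax; ∃-syntax; _×_; _,_; proj₁; proj₂)
open import Data.Sum.Base using (_⊎_; inj₁; inj₂; map₂)
open import Data.Vec.Base using (tabulate)
open import Data.Vec.Properties using (lookup∘tabulate; []=⇒lookup; lookup⇒[]=)
open import Function.Base using (id; _∘_; case_of_)
open import Function.Bundles using (Bijection; Injection; Equivalence; _⇔_; mk⇔)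
open import Function.Construct.Composition using (_⇔-∘_)
open import Function.Construct.Identity using (↔-id)
open import Function.Construct.Symmetry using (⇔-sym)
open import Function.Definitions using (Injective)
import Function.Endo.Propositional as Endo
open import Function.Properties.Inverse using (↔⇒↣)
open import Relation.Binary.Construct.Closure.ReflexiveTransitive using (ε; _◅_)
open import Relation.Binary.Construct.Closure.Symmetric using (fwd)
open import Relation.Binary.Construct.Closure.Transitive using (TransClosure; [_]; _∷_; _∷ʳ_)
open import Relation.Binary.Definitions using (tri<; tri≈; tri>)
open import Relation.Binary.PropositionalEquality
open import Relation.Nullary using (¬_; Dec; yes; no; does; contradiction)
open import Relation.Nullary.Decidable using (dec-true; dec-false; decidable-stable; ¬?; _×-dec_; _⊎-dec_)

open Equivalence using (to; from)

-- Iterates of an injective self-map of a finite set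

module _ {n : ℕ} (f : Fin n → Fin n) where

  ^-+ : ∀ i j x → (f ^ (i + j)) x ≡ (f ^ i) ((f ^ j) x)
  ^-+ i j = cong-app (Endo.^-homo (Fin n) f i j)

  ^-sucʳ : ∀ i x → (f ^ suc i) x ≡ (f ^ i) (f x)
  ^-sucʳ i x = trans (cong (λ k → (f ^ k) x) (+-comm 1 i)) (^-+ i 1 x)

  ^-% : ∀ {x} k → (f ^ suc k) x ≡ x → ∀ m → (f ^ (m % suc k)) x ≡ (f ^ m) x
  ^-% {x} k e m = sym (begin
    (f ^ m) x                                        ≡⟨ cong (λ i → (f ^ i) x) (m≡m%n+[m/n]*n m (suc k)) ⟩
    (f ^ (m % suc k + m / suc k * suc k)) x          ≡⟨ ^-+ (m % suc k) _ x ⟩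
    (f ^ (m % suc k)) ((f ^ (m / suc k * suc k)) x)  ≡⟨ cong (f ^ (m % suc k)) (multiple (m / suc k)) ⟩
    (f ^ (m % suc k)) x                              ∎)
    where
    open ≡-Reasoning
    multiple : ∀ q → (f ^ (q * suc k)) x ≡ x
    multiple zero    = refl
    multiple (suc q) = trans (^-+ (suc k) (q * suc k) x) (trans (cong (f ^ suc k) (multiple q)) e)

  -- Sending `x` to an exponent that reaches it, reduced modulo the period, is injective, because
  -- the reduced exponent still reaches `x`.
  generates⇒n≤period : ∀ {r} k → (f ^ suc k) r ≡ r → (∀ x → ∃[ i ] (f ^ i) r ≡ x) → n ≤ suc k
  generates⇒n≤period {r} k e onto = injective⇒≤ {f = index} index-injective
    where
    index : Fin n → Fin (suc k)
    index x = fromℕ< (m%n<n (proj₁ (onto x)) (suc k))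

    index-injective : Injective _≡_ _≡_ index
    index-injective {x} {y} eq = begin
      x                      ≡⟨ proj₂ (onto x) ⟨
      (f ^ i) r              ≡⟨ ^-% k e i ⟨
      (f ^ (i % suc k)) r    ≡⟨ cong (λ l → (f ^ l) r) (fromℕ<-injective _ _ (m%n<n i (suc k)) (m%n<n j (suc k)) eq) ⟩
      (f ^ (j % suc k)) r    ≡⟨ ^-% k e j ⟩
      (f ^ j) r              ≡⟨ proj₂ (onto y) ⟩
      y                      ∎
      where
      open ≡-Reasoning
      i j : ℕ
      i = proj₁ (onto x)
      j = proj₁ (onto y)

  module _ (f-injective : Injective _≡_ _≡_ f) where

    ^-injective : ∀ i → Injective _≡_ _≡_ (f ^ i)
    ^-injective zero    e = e
    ^-injective (suc i) e = ^-injective i (f-injective e)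

    ^-cancel : ∀ {i j x} → i < j → (f ^ i) x ≡ (f ^ j) x → ∃[ k ] suc k ≤ j × (f ^ suc k) x ≡ x
    ^-cancel {i} {x = x} i<j e with k , refl ← m≤n⇒∃[o]m+o≡n i<j =
      k , s≤s (m≤n+m k i) , sym (^-injective i (trans e
        (trans (cong (λ l → (f ^ l) x) (sym (+-suc i k))) (^-+ i (suc k) x))))

    period : ∀ x → ∃[ k ] suc k ≤ n × (f ^ suc k) x ≡ x
    period x =
      let i , j , i<j , e = pigeonhole (n<1+n n) (λ i → (f ^ toℕ i) x)
          k , k<j , e′    = ^-cancel i<j e
      in k , ≤-trans k<j (≤-pred (toℕ<n j)) , e′

    ^-reduce : ∀ m x → ∃[ i ] i < n × (f ^ i) x ≡ (f ^ m) x
    ^-reduce m x =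
      let k , k<n , e = period x
      in m % suc k , <-≤-trans (m%n<n m (suc k)) k<n , ^-% k e m

    -- Moving on around the cycle stands in for the inverse of `f`: a step is undone by the
    -- remaining steps of its period.
    ^-return : ∀ m x → ∃[ i ] (f ^ i) ((f ^ m) x) ≡ x
    ^-return zero    x = 0 , refl
    ^-return (suc m) x =
      let k , _ , e = period ((f ^ m) x)
          i , e′    = ^-return m x
      in i + k , trans (^-+ i k _) (trans (cong (f ^ i) (trans (sym (^-sucʳ k _)) e)) e′)

    generates⇒unique : ∀ {r} → (∀ x → ∃[ i ] (f ^ i) r ≡ x) →
                       ∀ {i j} → i < n → j < n → (f ^ i) r ≡ (f ^ j) r → i ≡ j
    generates⇒unique onto {i} {j} i<n j<n e with <-cmp i j
    ... | tri≈ _ i≡j _ = i≡j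
    ... | tri< i<j _ _ =
      let k , k<j , e′ = ^-cancel i<j e
      in contradiction (<-≤-trans j<n (≤-trans (generates⇒n≤period k e′ onto) k<j)) (<-irrefl refl)
    ... | tri> _ _ j<i =
      let k , k<i , e′ = ^-cancel j<i (sym e)
      in contradiction (<-≤-trans i<n (≤-trans (generates⇒n≤period k e′ onto) k<i)) (<-irrefl refl)

-- Subsets given by decidable predicates

module _ {n : ℕ} {P : Fin n → Set} (P? : ∀ x → Dec (P x)) where

  ∈-tabulate : ∀ {x} → x ∈ tabulate (does ∘ P?) ⇔ P x
  ∈-tabulate {x} = mk⇔ elim intro
    where
    intro : P x → x ∈ tabulate (does ∘ P?)
    intro p = lookup⇒[]= x _ (trans (lookup∘tabulate _ x) (dec-true (P? x) p))
    elim : x ∈ tabulate (does ∘ P?) → P x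
    elim x∈ with P? x in eq
    ... | yes p = p
    ... | no ¬p = contradiction (trans (sym ([]=⇒lookup x∈)) (trans (lookup∘tabulate _ x) (cong does eq))) λ ()

-- Covered maps as the maps with cyclic motion function

module _ (M : RootedMap) where
  open RootedMap M

  σ-injective : Injective _≡_ _≡_ σ
  σ-injective = Injection.injective (↔⇒↣ σ-perm)

  α-injective : Injective _≡_ _≡_ α
  α-injective {x} {y} e = trans (sym (α-involutive x)) (trans (cong α e) (α-involutive y))

module _ (A : MarkedMap) where
  open MarkedMap A renaming (marked to S)

  θ-∈ : ∀ {h} → h ∈ S → θ A h ≡ σ (α h)
  θ-∈ {h} h∈S rewrite dec-true (h ∈? S) h∈S = refl

  θ-∉ : ∀ {h} → h ∉ S → θ A h ≡ σ h
  θ-∉ {h} h∉S rewrite dec-false (h ∈? S) h∉S = refl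

  Stable : Set
  Stable = ∀ {h} → h ∈ S → α h ∈ S

  stable⁻ : Stable → ∀ {h} → α h ∈ S → h ∈ S
  stable⁻ stable {h} p = subst (_∈ S) (α-involutive h) (stable p)

  -- Stability rules out the mixed case: `σ (α x) ≡ σ y` gives `α x ≡ y`, so `x` and `y` lie on the
  -- same side of `S`.
  θ-injective : Stable → Injective _≡_ _≡_ (θ A)
  θ-injective stable {x} {y} e with x ∈? S | y ∈? S
  ... | yes _  | yes _  = α-injective map (σ-injective map e)
  ... | no _   | no _   = σ-injective map e
  ... | yes p  | no ¬q  = contradiction (subst (_∈ S) (σ-injective map e) (stable p)) ¬q
  ... | no ¬p  | yes q  = contradiction (subst (_∈ S) (sym (σ-injective map e)) (stable q)) ¬p

  Appears : H → Set
  Appears x = ∃[ i ] i < size × (θ A ^ i) root ≡ x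

  -- Since `stable` makes `θ A` injective, the orbit of `root` being everything means that `θ A` is
  -- a single cycle.
  record IsCyclic : Set where
    field
      stable  : Stable
      appears : ∀ x → Appears x

  -- First returns of the motion function to `S`

  firstIn-∈ : ∀ {π x} k → x ∈ S → firstIn S π k x ≡ x
  firstIn-∈     zero    x∈S = refl
  firstIn-∈ {x = x} (suc k) x∈S rewrite dec-true (x ∈? S) x∈S = refl

  -- Outside `S` the maps `θ A` and `σ` coincide, so searching for `S` along `σ` is searching along
  -- `θ A`.
  firstIn-θ : ∀ k x → ∃[ j ] firstIn S σ k x ≡ (θ A ^ j) x
  firstIn-θ zero    x = 0 , refl
  firstIn-θ (suc k) x with x ∈? S
  ... | yes _ = 0 , refl
  ... | no ¬p =
    let j , e = firstIn-θ k (σ x)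
    in suc j , trans e (trans (cong (θ A ^ j) (sym (θ-∉ ¬p))) (sym (^-sucʳ (θ A) j x)))

  firstIn-θ-∈ : ∀ {x} j k → j ≤ k → (θ A ^ j) x ∈ S →
                ∃[ i ] i ≤ j × firstIn S σ k x ≡ (θ A ^ i) x × firstIn S σ k x ∈ S
  firstIn-θ-∈ {x} zero k _ x∈S = 0 , z≤n , firstIn-∈ k x∈S , subst (_∈ S) (sym (firstIn-∈ k x∈S)) x∈S
  firstIn-θ-∈ {x} (suc j) (suc k) (s≤s j≤k) y∈S with x ∈? S
  ... | yes x∈S = 0 , z≤n , refl , x∈S
  ... | no  x∉S =
    let step          = λ i → trans (^-sucʳ (θ A) i x) (cong (θ A ^ i) (θ-∉ x∉S))
        i , i≤j , e , p = firstIn-θ-∈ j k j≤k (subst (_∈ S) (step j) y∈S)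
    in suc i , s≤s i≤j , trans e (sym (step i)) , p

  private
    -- The face permutation of the submap on `S`, extended by the identity outside `S`.
    ψ : H → H
    ψ = (σ ∣ᵣ S) ∘ (α ∣ᵣ S)

  ∣ᵣ-∈ : ∀ {π h} → h ∈ S → (π ∣ᵣ S) h ≡ firstIn S π size (π h)
  ∣ᵣ-∈ {h = h} h∈S rewrite dec-true (h ∈? S) h∈S = refl

  ∣ᵣ-∉ : ∀ {π h} → h ∉ S → (π ∣ᵣ S) h ≡ h
  ∣ᵣ-∉ {h = h} h∉S rewrite dec-false (h ∈? S) h∉S = refl

  module _ (stable : Stable) where

    -- Stability gives `α h ∈ S`, so on `S` a `ψ`-step starts as a `θ A`-step and then searches for
    -- `S`.
    ψ-∈ : ∀ {h} → h ∈ S → ψ h ≡ firstIn S σ size (θ A h)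
    ψ-∈ {h} h∈S = begin
      (σ ∣ᵣ S) ((α ∣ᵣ S) h)            ≡⟨ cong (σ ∣ᵣ S) (trans (∣ᵣ-∈ h∈S) (firstIn-∈ size (stable h∈S))) ⟩
      (σ ∣ᵣ S) (α h)                   ≡⟨ ∣ᵣ-∈ (stable h∈S) ⟩
      firstIn S σ size (σ (α h))       ≡⟨ cong (firstIn S σ size) (θ-∈ h∈S) ⟨
      firstIn S σ size (θ A h)         ∎
      where open ≡-Reasoning

    ψ-∉ : ∀ {h} → h ∉ S → ψ h ≡ h
    ψ-∉ h∉S = trans (cong (σ ∣ᵣ S) (∣ᵣ-∉ h∉S)) (∣ᵣ-∉ h∉S)

    ψ-θ : ∀ h → ∃[ j ] ψ h ≡ (θ A ^ j) h
    ψ-θ h = case h ∈? S of λ where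
      (yes h∈S) →
        let j , e = firstIn-θ size (θ A h)
        in suc j , trans (ψ-∈ h∈S) (trans e (sym (^-sucʳ (θ A) j h)))
      (no h∉S) → 0 , ψ-∉ h∉S

    ψ^-θ : ∀ k h → ∃[ j ] (ψ ^ k) h ≡ (θ A ^ j) h
    ψ^-θ zero    h = 0 , refl
    ψ^-θ (suc k) h =
      let i , e  = ψ^-θ k h
          j , e′ = ψ-θ ((ψ ^ k) h)
      in j + i , trans e′ (trans (cong (θ A ^ j) e) (sym (^-+ (θ A) j i h)))

    -- Strong induction on the number of steps: one `ψ`-step jumps to the first return to `S`, which
    -- comes no later than `y`. The bound `m < size` keeps that return within the fuel of `firstIn`.
    θ^-ψ : ∀ m {x y} → m < size → x ∈ S → y ∈ S → (θ A ^ m) x ≡ y → ∃[ k ] (ψ ^ k) x ≡ y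
    θ^-ψ = <-rec _ step
      where
      step : ∀ m → (∀ {l} → l < m → ∀ {x y} → l < size → x ∈ S → y ∈ S → (θ A ^ l) x ≡ y → ∃[ k ] (ψ ^ k) x ≡ y) →
             ∀ {x y} → m < size → x ∈ S → y ∈ S → (θ A ^ m) x ≡ y → ∃[ k ] (ψ ^ k) x ≡ y
      step zero    rec m<n x∈S y∈S e = 0 , e
      step (suc m) rec {x} {y} m<n x∈S y∈S e
        with firstIn-θ-∈ m size (≤-trans (n≤1+n m) (<⇒≤ m<n)) (subst (_∈ S) (trans (sym e) (^-sucʳ (θ A) m x)) y∈S)
      -- `o` counts the `θ A`-steps left after the first return.
      ... | i , i≤m , e₁ , p with o , refl ← m≤n⇒∃[o]m+o≡n i≤m =
        let ψx≡ : ψ x ≡ (θ A ^ i) (θ A x)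
            ψx≡ = trans (ψ-∈ x∈S) e₁
            o≤m : o ≤ i + o
            o≤m = m≤n+m o i
            k , e₂ = rec (s≤s o≤m) (<-trans (s≤s o≤m) m<n) (subst (_∈ S) (sym (ψ-∈ x∈S)) p) y∈S
                       (begin
                         (θ A ^ o) (ψ x)                    ≡⟨ cong (θ A ^ o) ψx≡ ⟩
                         (θ A ^ o) ((θ A ^ i) (θ A x))      ≡⟨ ^-+ (θ A) o i _ ⟨
                         (θ A ^ (o + i)) (θ A x)            ≡⟨ cong (λ l → (θ A ^ l) (θ A x)) (+-comm o i) ⟩
                         (θ A ^ (i + o)) (θ A x)            ≡⟨ ^-sucʳ (θ A) (i + o) x ⟨
                         (θ A ^ suc (i + o)) x              ≡⟨ e ⟩
                         y                                  ∎)
        in suc k , trans (^-sucʳ ψ k x) e₂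
        where open ≡-Reasoning

  -- `σ` and `θ A` trace the same path up to the first point of `S`.
  σ^-∈ : ∀ k {h} → (σ ^ k) h ∈ S → ∃[ j ] (θ A ^ j) h ∈ S
  σ^-∈ zero    p = 0 , p
  σ^-∈ (suc k) {h} p with h ∈? S
  ... | yes h∈S = 0 , h∈S
  ... | no  h∉S =
    let j , q = σ^-∈ k (subst (_∈ S) (^-sucʳ σ k h) p)
    in suc j , subst (_∈ S) (sym (trans (^-sucʳ (θ A) j h) (cong (θ A ^ j) (θ-∉ h∉S)))) q

  θ^-∈ : ∀ j {h} → (θ A ^ j) h ∈ S → ∃[ k ] (σ ^ k) h ∈ S
  θ^-∈ zero    p = 0 , p
  θ^-∈ (suc j) {h} p with h ∈? S
  ... | yes h∈S = 0 , h∈S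
  ... | no  h∉S =
    let k , q = θ^-∈ j (subst (_∈ S) (trans (^-sucʳ (θ A) j h) (cong (θ A ^ j) (θ-∉ h∉S))) p)
    in suc k , subst (_∈ S) (sym (^-sucʳ σ k h)) q

  Empty⇒θ^≡σ^ : Empty S → ∀ k h → (θ A ^ k) h ≡ (σ ^ k) h
  Empty⇒θ^≡σ^ empty zero    h = refl
  Empty⇒θ^≡σ^ empty (suc k) h = trans (θ-∉ (λ p → empty (_ , p))) (cong σ (Empty⇒θ^≡σ^ empty k h))

  covered⇒cyclic : IsCovered A → IsCyclic
  covered⇒cyclic cov = record { stable = stable ; appears = λ x → reduce (reach connecting x) }
    where
    open IsCovered cov
    reduce : ∀ {x} → ∃[ m ] (θ A ^ m) root ≡ x → Appears x
    reduce (m , e) = let i , i<n , e′ = ^-reduce (θ A) (θ-injective stable) m root in i , i<n , trans e′ e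

    reach : (∀ h → ∃[ k ] (σ ^ k) h ∈ S) ⊎ (Empty S × OneVertex A) → ∀ x → ∃[ m ] (θ A ^ m) root ≡ x
    reach (inj₂ (empty , oneVertex)) x =
      let k , e = oneVertex root x in k , trans (Empty⇒θ^≡σ^ empty k root) e
    -- Follow `θ A` from `root` into `S`, go around the single face of the submap to a point of `S`
    -- on the orbit of `x`, then return to `x`.
    reach (inj₁ meets) x =
      let a , p = σ^-∈ (proj₁ (meets root)) {root} (proj₂ (meets root))
          b , q = σ^-∈ (proj₁ (meets x)) {x} (proj₂ (meets x))
          k , e = unicellular p q
          j , f = ψ^-θ stable k ((θ A ^ a) root)
          c , g = ^-return (θ A) (θ-injective stable) b x
      in c + (j + a) , (begin
        (θ A ^ (c + (j + a))) root                  ≡⟨ ^-+ (θ A) c (j + a) root ⟩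
        (θ A ^ c) ((θ A ^ (j + a)) root)            ≡⟨ cong (θ A ^ c) (^-+ (θ A) j a root) ⟩
        (θ A ^ c) ((θ A ^ j) ((θ A ^ a) root))      ≡⟨ cong (θ A ^ c) (trans (sym f) e) ⟩
        (θ A ^ c) ((θ A ^ b) x)                     ≡⟨ g ⟩
        x                                           ∎)
      where open ≡-Reasoning

  cyclic⇒covered : IsCyclic → IsCovered A
  cyclic⇒covered cyc = record
    { stable      = stable
    ; transitiveS = λ p q → let k , e = unicellular p q in subst (SameOrbit _ _ _) e (ψ^-orbit k)
    ; connecting  = connecting
    ; unicellular = unicellular
    }
    where
    open IsCyclic cyc
    reach : ∀ x y → ∃[ m ] m < size × (θ A ^ m) x ≡ y
    reach x y =
      let i , _ , e = appears x
          j , _ , f = appears y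
          c , g     = ^-return (θ A) (θ-injective stable) i root
          m , m<n , h = ^-reduce (θ A) (θ-injective stable) (j + c) x
      in m , m<n , trans h (trans (^-+ (θ A) j c x)
           (trans (cong (θ A ^ j) (trans (cong (θ A ^ c) (sym e)) g)) f))

    unicellular : ∀ {x y} → x ∈ S → y ∈ S → ∃[ k ] (ψ ^ k) x ≡ y
    unicellular {x} {y} p q = let m , m<n , e = reach x y in θ^-ψ stable m m<n p q e

    -- One `ψ`-step is an `α`-step followed by a `σ`-step of the submap, so transitivity on `S`
    -- follows from unicellularity.
    ψ^-orbit : ∀ k {x} → SameOrbit (σ ∣ᵣ S) (α ∣ᵣ S) x ((ψ ^ k) x)
    ψ^-orbit zero    = ε
    ψ^-orbit (suc k) {x} = subst (SameOrbit _ _ x) (sym (^-sucʳ ψ k x))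
      (fwd (inj₂ refl) ◅ fwd (inj₁ refl) ◅ ψ^-orbit k)

    -- The one cycle of `θ A` passes through `S` if `S` is inhabited; otherwise it is a cycle of
    -- `σ`, and the map has one vertex.
    connecting : (∀ h → ∃[ k ] (σ ^ k) h ∈ S) ⊎ (Empty S × OneVertex A)
    connecting with any? (_∈? S)
    ... | yes (s , s∈S) = inj₁ λ h →
      let m , _ , e = reach h s in θ^-∈ m {h} (subst (_∈ S) (sym e) s∈S)
    ... | no empty = inj₂ (empty , λ x y →
      let m , _ , e = reach x y in m , trans (sym (Empty⇒θ^≡σ^ empty m x)) e)

-- The appearance order of a map with cyclic motion function

module _ (A : MarkedMap) where
  open MarkedMap A

  index⇒≺ : ∀ {i j x y} → i < j → j < size → (θ A ^ i) root ≡ x → (θ A ^ j) root ≡ y → _≺_ A x y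
  index⇒≺ {i} {j} i<j j<n e f =
      fromℕ< i<n , fromℕ< j<n
    , subst₂ _<_ (sym (toℕ-fromℕ< i<n)) (sym (toℕ-fromℕ< j<n)) i<j
    , trans (cong (λ l → (θ A ^ l) root) (toℕ-fromℕ< i<n)) e
    , trans (cong (λ l → (θ A ^ l) root) (toℕ-fromℕ< j<n)) f
    where
    i<n : i < size
    i<n = <-trans i<j j<n

  ∈Δ : ∀ {h} → h ∈ MarkedMap.marked (Δ A) ⇔ Incoming A h
  ∈Δ = ∈-tabulate (incoming? A)

  -- This is what `Incoming` amounts to at the half-edge of an edge that is visited first.
  FirstVisitRule : Subset size → Set
  FirstVisitRule I = ∀ {h} → _≺_ A h (α h) → h ∈ marked ⇔ h ∉ I

module Cyclic (A : MarkedMap) (cyclic : IsCyclic A) where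
  open MarkedMap A renaming (marked to S)
  open IsCyclic cyclic public

  pos : H → ℕ
  pos x = proj₁ (appears x)

  pos<size : ∀ x → pos x < size
  pos<size x = proj₁ (proj₂ (appears x))

  θ^pos : ∀ x → (θ A ^ pos x) root ≡ x
  θ^pos x = proj₂ (proj₂ (appears x))

  pos-unique : ∀ {i x} → i < size → (θ A ^ i) root ≡ x → i ≡ pos x
  pos-unique {x = x} i<n e = generates⇒unique (θ A) (θ-injective A stable)
    (λ y → pos y , θ^pos y) i<n (pos<size x) (trans e (sym (θ^pos x)))

  ≺⇔pos< : ∀ {x y} → _≺_ A x y ⇔ pos x < pos y
  ≺⇔pos< {x} {y} = mk⇔
    (λ (i , j , i<j , e , f) → subst₂ _<_ (pos-unique (toℕ<n i) e) (pos-unique (toℕ<n j) f) i<j)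
    (λ p → index⇒≺ A p (pos<size y) (θ^pos x) (θ^pos y))

  ≺-asym : ∀ {x y} → _≺_ A x y → ¬ _≺_ A y x
  ≺-asym p q = <-asym (to ≺⇔pos< p) (to ≺⇔pos< q)

  ≺-α-total : ∀ h → _≺_ A h (α h) ⊎ _≺_ A (α h) h
  ≺-α-total h with <-cmp (pos h) (pos (α h))
  ... | tri< p _ _ = inj₁ (from ≺⇔pos< p)
  ... | tri> _ _ q = inj₂ (from ≺⇔pos< q)
  ... | tri≈ _ e _ = contradiction
    (trans (sym (θ^pos (α h))) (trans (cong (λ l → (θ A ^ l) root) (sym e)) (θ^pos h))) (α-noFixed h)

  -- `pos h` is the least index of `h`, so it is at most `i` even when `i` is not below `size`; if
  -- `α h` preceded `h`, it would be visited before time `i`.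
  first⇒≺α : ∀ {i h} → (θ A ^ i) root ≡ h → (∀ {j} → j < i → (θ A ^ j) root ≢ α h) → _≺_ A h (α h)
  first⇒≺α {i} {h} e fresh = case ≺-α-total h of λ where
      (inj₁ h≺αh) → h≺αh
      (inj₂ αh≺h) → contradiction (θ^pos (α h)) (fresh (<-≤-trans (to ≺⇔pos< αh≺h) pos≤i))
    where
    pos≤i : pos h ≤ i
    pos≤i with i <? size
    ... | yes i<n = ≤-reflexive (sym (pos-unique i<n e))
    ... | no  i≮n = <⇒≤ (<-≤-trans (pos<size h) (≮⇒≥ i≮n))

  -- Positions grow by one except where the cycle closes up: by injectivity, the preimage of `y` is
  -- the half-edge at the preceding index.
  pos-θ : ∀ {x y} → θ A x ≡ y → y ≡ root ⊎ pos y ≡ suc (pos x)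
  pos-θ {x} {y} e with pos y in eq
  ... | zero  = inj₁ (trans (sym (θ^pos y)) (cong (λ l → (θ A ^ l) root) eq))
  ... | suc m = inj₂ (cong suc (pos-unique
    (<-trans (n<1+n m) (subst (_< size) eq (pos<size y)))
    (θ-injective A stable (trans (trans (cong (λ l → (θ A ^ l) root) (sym eq)) (θ^pos y)) (sym e)))))

  -- By stability `h` and `α h` lie on the same side of `S`, where being incoming asks for opposite
  -- orders of the two.
  incoming-α⁻ : ∀ {h} → Incoming A h → ¬ Incoming A (α h)
  incoming-α⁻ (inj₁ (h∈S , _))    (inj₂ (αh∉S , _))    = αh∉S (stable h∈S)
  incoming-α⁻ (inj₂ (h∉S , _))    (inj₁ (αh∈S , _))    = h∉S (stable⁻ A stable αh∈S)
  incoming-α⁻ {h} (inj₁ (_ , αh≺h)) (inj₁ (_ , p)) =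
    ≺-asym αh≺h (subst (λ x → _≺_ A x (α h)) (α-involutive h) p)
  incoming-α⁻ {h} (inj₂ (_ , h≺αh)) (inj₂ (_ , p)) =
    ≺-asym h≺αh (subst (_≺_ A (α h)) (α-involutive h) p)

  incoming-α⁺ : ∀ {h} → ¬ Incoming A h → Incoming A (α h)
  incoming-α⁺ {h} ¬in with h ∈? S | ≺-α-total h
  ... | yes h∈S | inj₁ p = inj₁ (stable h∈S , subst (λ x → _≺_ A x (α h)) (sym (α-involutive h)) p)
  ... | yes h∈S | inj₂ p = contradiction (inj₁ (h∈S , p)) ¬in
  ... | no  h∉S | inj₁ p = contradiction (inj₂ (h∉S , p)) ¬in
  ... | no  h∉S | inj₂ p = inj₂ (h∉S ∘ stable⁻ A stable , subst (_≺_ A (α h)) (sym (α-involutive h)) p)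

  Δ-firstVisitRule : FirstVisitRule A (MarkedMap.marked (Δ A))
  Δ-firstVisitRule {h} h≺αh = mk⇔
    (λ h∈S h∈I → case to (∈Δ A) h∈I of λ where
      (inj₁ (_ , αh≺h)) → ≺-asym αh≺h h≺αh
      (inj₂ (h∉S , _))  → h∉S h∈S)
    (λ h∉I → decidable-stable (h ∈? S) λ h∉S → h∉I (from (∈Δ A) (inj₂ (h∉S , h≺αh))))

  -- Left paths of Δ A

  private
    I : Subset size
    I = MarkedMap.marked (Δ A)

  Δ-oriented : IsOriented (Δ A)
  Δ-oriented h = mk⇔
    (λ h∈O → α h , from (∈Δ A) (incoming-α⁺ (λ p → x∈∁p⇒x∉p h∈O (from (∈Δ A) p))) , α-involutive h)
    (λ (x , x∈I , αx≡h) → subst (_∈ O (Δ A)) αx≡h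
      (x∉p⇒x∈∁p (λ p → incoming-α⁻ (to (∈Δ A) x∈I) (to (∈Δ A) p))))

  -- The later of `h` and `α h` is the `θ A`-preimage of `σ (α h)`: it is `h` when `h ∈ S` and `α h`
  -- otherwise.
  σα-after-edge : ∀ {h} → h ∈ I → σ (α h) ≡ root ⊎ (pos h < pos (σ (α h)) × pos (α h) < pos (σ (α h)))
  σα-after-edge {h} h∈I = case to (∈Δ A) h∈I of λ where
      (inj₁ (h∈S , αh≺h)) → after (θ-∈ A h∈S) ≤-refl (<⇒≤ (to ≺⇔pos< αh≺h))
      (inj₂ (h∉S , h≺αh)) → after (θ-∉ A (h∉S ∘ stable⁻ A stable)) (<⇒≤ (to ≺⇔pos< h≺αh)) ≤-refl
    where
    after : ∀ {x} → θ A x ≡ σ (α h) → pos h ≤ pos x → pos (α h) ≤ pos x →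
            σ (α h) ≡ root ⊎ (pos h < pos (σ (α h)) × pos (α h) < pos (σ (α h)))
    after e p q = case pos-θ e of λ where
      (inj₁ r) → inj₁ r
      (inj₂ s) → inj₂ (subst (pos h <_) (sym s) (s≤s p) , subst (pos (α h) <_) (sym s) (s≤s q))

  -- The edge of `g` is seen from its incoming half `α g`.
  σ-after : ∀ {g} → g ∉ I → σ g ≡ root ⊎ pos g < pos (σ g)
  σ-after {g} g∉I with σα-after-edge {α g} (from (∈Δ A) (incoming-α⁺ (g∉I ∘ from (∈Δ A))))
  ... | inj₁ r       rewrite α-involutive g = inj₁ r
  ... | inj₂ (_ , p) rewrite α-involutive g = inj₂ p

  -- A turn around a vertex through outgoing half-edges. Ending at `root` is allowed even if
  -- `root ∉ I`, since left-paths start there.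
  Walk : H → Set
  Walk g = ∃[ q ] (∀ p → p < q → (σ ^ p) g ∉ I) ×
                  ((σ ^ q) g ≡ root ⊎ ((σ ^ q) g ∈ I × pos g ≤ pos ((σ ^ q) g)))

  walk : ∀ g → Walk g
  walk g = go g (<-wellFounded (size ∸ pos g))
    where
    go : ∀ g → Acc _<_ (size ∸ pos g) → Walk g
    go g (acc rec) with g ∈? I
    ... | yes g∈I = 0 , (λ _ ()) , inj₂ (g∈I , ≤-refl)
    ... | no  g∉I with σ-after g∉I
    ...   | inj₁ r = 1 , (λ { zero _ → g∉I ; (suc _) (s≤s ()) }) , inj₁ r
    ...   | inj₂ g<σg =
      let q , out , end = go (σ g) (rec (∸-monoʳ-< g<σg (<⇒≤ (pos<size (σ g)))))
          step = ^-sucʳ σ q g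
      in suc q
       , (λ { zero _ → g∉I ; (suc p) (s≤s p<q) → subst (_∉ I) (sym (^-sucʳ σ p g)) (out p p<q) })
       , subst (λ t → t ≡ root ⊎ (t ∈ I × pos g ≤ pos t)) (sym step)
           (map₂ (λ (t∈I , le) → t∈I , ≤-trans (<⇒≤ g<σg) le) end)

  α∈O : ∀ {h} → h ∈ I → α h ∈ O (Δ A)
  α∈O {h} h∈I = from (Δ-oriented (α h)) (h , h∈I , refl)

  -- The left-path is found backwards from its last element: the turn from `α h` ends at `root` or
  -- at an incoming half-edge visited later than `h`, so `size ∸ pos h` decreases.
  Δ-leftConnected : IsLeftConnected (Δ A)
  Δ-leftConnected {h} = go h (<-wellFounded (size ∸ pos h))
    where
    go : ∀ h → Acc _<_ (size ∸ pos h) → h ∈ I → EndsLeftPath (Δ A) h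
    go h (acc rec) h∈I with σα-after-edge h∈I
    ... | inj₁ r = [ h∈I , 1 , s≤s z≤n , sym r , (λ { zero _ → α∈O h∈I ; (suc _) (s≤s ()) }) ]
    ... | inj₂ (h<σαh , _) with walk (σ (α h))
    ...   | q , out , end = finish end
      where
      out′ : ∀ p → p < suc q → (σ ^ p) (α h) ∈ O (Δ A)
      out′ zero    _         = α∈O h∈I
      out′ (suc p) (s≤s p<q) = x∉p⇒x∈∁p (subst (_∉ I) (sym (^-sucʳ σ p (α h))) (out p p<q))
      leftStep : LeftStep (Δ A) ((σ ^ q) (σ (α h))) h
      leftStep = h∈I , suc q , s≤s z≤n , sym (^-sucʳ σ q (α h)) , out′
      finish : (σ ^ q) (σ (α h)) ≡ root ⊎ ((σ ^ q) (σ (α h)) ∈ I × pos (σ (α h)) ≤ pos ((σ ^ q) (σ (α h)))) →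
               EndsLeftPath (Δ A) h
      finish (inj₁ r) = [ subst (λ t → LeftStep (Δ A) t h) r leftStep ]
      finish (inj₂ (t∈I , le)) =
        go _ (rec (∸-monoʳ-< (<-≤-trans h<σαh le) (<⇒≤ (pos<size _)))) t∈I ∷ʳ leftStep

  -- The rule decides first-visited half-edges. For the opposite ones, stability carries membership
  -- in `S` across the edge while `orient` negates membership in `I`, which gives `rule′`.
  firstVisitRule⇒Δ : ∀ {I} → FirstVisitRule A I → (∀ {h} → α h ∈ I ⇔ h ∉ I) → ∀ {h} → Incoming A h ⇔ h ∈ I
  firstVisitRule⇒Δ {I} rule orient {h} = mk⇔ sound complete
    where
    rule′ : ∀ {h} → _≺_ A (α h) h → h ∈ S ⇔ h ∈ I
    rule′ {h} p = mk⇔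
      (λ h∈S → decidable-stable (h ∈? I) λ h∉I →
        to (rule p′) (stable h∈S) (from orient h∉I))
      (λ h∈I → stable⁻ A stable (from (rule p′) λ αh∈I → to orient αh∈I h∈I))
      where
      p′ : _≺_ A (α h) (α (α h))
      p′ = subst (_≺_ A (α h)) (sym (α-involutive h)) p
    sound : Incoming A h → h ∈ I
    sound (inj₁ (h∈S , αh≺h)) = to (rule′ αh≺h) h∈S
    sound (inj₂ (h∉S , h≺αh)) = decidable-stable (h ∈? I) (h∉S ∘ from (rule h≺αh))
    complete : h ∈ I → Incoming A h
    complete h∈I = case ≺-α-total h of λ where
      (inj₁ h≺αh) → inj₂ ((λ h∈S → to (rule h≺αh) h∈S h∈I) , h≺αh)
      (inj₂ αh≺h) → inj₁ (from (rule′ αh≺h) h∈I , αh≺h)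

Δ-leftConnectedOriented : ∀ {A} → IsCovered A → IsLeftConnectedOriented (Δ A)
Δ-leftConnectedOriented {A} cov = record { oriented = Δ-oriented ; leftConnected = Δ-leftConnected }
  where open Cyclic A (covered⇒cyclic A cov)

-- Relabellings

module _ (A B : MarkedMap) where
  private
    module A = MarkedMap A
    module B = MarkedMap B

  -- Only the side of the single half-edge `h` is assumed, so that orbits can be compared step by
  -- step before the sets are known to agree.
  θ-commute : ∀ {f : A.H → B.H} → (∀ h → f (A.σ h) ≡ B.σ (f h)) → (∀ h → f (A.α h) ≡ B.α (f h)) →
              ∀ {h} → h ∈ A.marked ⇔ f h ∈ B.marked → f (θ A h) ≡ θ B (f h)
  θ-commute {f} σ-compat α-compat {h} side = case h ∈? A.marked of λ where
    (yes p) → trans (cong f (θ-∈ A p)) (trans (σ-compat _)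
                (trans (cong B.σ (α-compat h)) (sym (θ-∈ B (to side p)))))
    (no ¬p) → trans (cong f (θ-∉ A ¬p)) (trans (σ-compat h) (sym (θ-∉ B (¬p ∘ from side))))

module _ {A B : MarkedMap} (iso : A ≅ B) where
  private
    module A = MarkedMap A
    module B = MarkedMap B
    open _≅_ iso
    f : A.H → B.H
    f = relabel ⟨$⟩ʳ_

  relabel-θ^ : ∀ i → f ((θ A ^ i) A.root) ≡ (θ B ^ i) B.root
  relabel-θ^ zero    = root-compat
  relabel-θ^ (suc i) = trans (θ-commute A B σ-compat α-compat (set-compat _)) (cong (θ B) (relabel-θ^ i))

  relabel-≺ : ∀ {x y} → _≺_ A x y → _≺_ B (f x) (f y)
  relabel-≺ (i , j , i<j , e , e′) =
    index⇒≺ B i<j (subst (toℕ j <_) (↔⇒≡ relabel) (toℕ<n j))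
      (trans (sym (relabel-θ^ (toℕ i))) (cong f e))
      (trans (sym (relabel-θ^ (toℕ j))) (cong f e′))

  relabel-incoming : ∀ {h} → Incoming A h → Incoming B (f h)
  relabel-incoming {h} (inj₁ (p , q)) =
    inj₁ (to (set-compat h) p , subst (λ x → _≺_ B x (f h)) (α-compat h) (relabel-≺ q))
  relabel-incoming {h} (inj₂ (p , q)) =
    inj₂ (p ∘ from (set-compat h) , subst (_≺_ B (f h)) (α-compat h) (relabel-≺ q))

Δ-cong : ∀ {A B} → A ≅ B → Δ A ≅ Δ B
Δ-cong {A} {B} iso = record
  { relabel     = relabel
  ; σ-compat    = σ-compat
  ; α-compat    = α-compat
  ; root-compat = root-compat
  ; set-compat  = λ h → mk⇔
      (from (∈Δ B) ∘ relabel-incoming iso ∘ to (∈Δ A))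
      (λ p → from (∈Δ A) (subst (Incoming A) (inverseˡ relabel) (relabel-incoming (≅-sym iso) (to (∈Δ B) p))))
  }
  where open _≅_ iso

-- Whether the half-edge visited at time i lies in S is read off the orientation
-- or, at the second visit to an edge, off the first visit.

module _ {A B : MarkedMap} (cyclicA : IsCyclic A) (cyclicB : IsCyclic B) (iso : Δ A ≅ Δ B) where
  private
    module A = MarkedMap A
    module B = MarkedMap B
    module CA = Cyclic A cyclicA
    module CB = Cyclic B cyclicB
    open _≅_ iso
    f : A.H → B.H
    f = relabel ⟨$⟩ʳ_
    f-injective : Injective _≡_ _≡_ f
    f-injective = Injection.injective (↔⇒↣ relabel)

    a : ℕ → A.H
    a i = (θ A ^ i) A.root
    b : ℕ → B.H
    b i = (θ B ^ i) B.root

    SameSide : A.H → Set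
    SameSide h = h ∈ A.marked ⇔ f h ∈ B.marked

    ¬-cong : ∀ {P Q : Set} → P ⇔ Q → (¬ P) ⇔ (¬ Q)
    ¬-cong e = mk⇔ (λ ¬p q → ¬p (from e q)) (λ ¬q p → ¬q (to e p))

    sameSide-α : ∀ {h} → SameSide (A.α h) → SameSide h
    sameSide-α {h} e = mk⇔
      (λ p → stable⁻ B CB.stable (subst (_∈ B.marked) (α-compat h) (to e (CA.stable p))))
      (λ p → stable⁻ A CA.stable (from e (subst (_∈ B.marked) (sym (α-compat h)) (CB.stable p))))

    sameSide-first : ∀ i → (∀ {j} → j ≤ i → f (a j) ≡ b j) → (∀ {j} → j < i → a j ≢ A.α (a i)) → SameSide (a i)
    sameSide-first i eq fresh =
      ⇔-sym (CB.Δ-firstVisitRule (CB.first⇒≺α (sym (eq ≤-refl)) freshB)) ⇔-∘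
      (¬-cong (set-compat (a i)) ⇔-∘ CA.Δ-firstVisitRule (CA.first⇒≺α refl fresh))
      where
      freshB : ∀ {j} → j < i → b j ≢ B.α (f (a i))
      freshB j<i e = fresh j<i (f-injective (trans (eq (<⇒≤ j<i)) (trans e (sym (α-compat (a i))))))

    sameSide : ∀ i → (∀ {j} → j ≤ i → f (a j) ≡ b j) → SameSide (a i)
    sameSide = <-rec (λ i → (∀ {j} → j ≤ i → f (a j) ≡ b j) → SameSide (a i)) λ i rec eq →
      case anyUpTo? (λ j → a j ≟ A.α (a i)) i of λ where
        (yes (j , j<i , e)) → sameSide-α (subst SameSide e (rec j<i (λ {l} l≤j → eq (≤-trans l≤j (<⇒≤ j<i)))))
        (no ¬e)             → sameSide-first i eq (λ j<i e → ¬e (_ , j<i , e))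

    -- Agreement up to time `j` settles the side of the half-edge visited then, and that side fixes
    -- the visit at time `suc j`.
    agree : ∀ i {j} → j ≤ i → f (a j) ≡ b j
    agree i       {zero}  _         = root-compat
    agree (suc i) {suc j} (s≤s j≤i) =
      trans (θ-commute A B σ-compat α-compat (sameSide j (λ l≤j → agree i (≤-trans l≤j j≤i)))) (cong (θ B) (agree i j≤i))

  Δ-reflects-≅ : A ≅ B
  Δ-reflects-≅ = record
    { relabel     = relabel
    ; σ-compat    = σ-compat
    ; α-compat    = α-compat
    ; root-compat = root-compat
    ; set-compat  = λ h → subst SameSide (CA.θ^pos h) (sameSide (CA.pos h) (agree (CA.pos h)))
    }

-- Reconstruction of S from a left-connected orientation

module Reconstruct (B : MarkedMap) (lco : IsLeftConnectedOriented B) where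
  open MarkedMap B renaming (marked to I; map to M)
  open IsLeftConnectedOriented lco

  α∈I⇔∉I : ∀ {h} → α h ∈ I ⇔ h ∉ I
  α∈I⇔∉I {h} = mk⇔
    (λ p → x∈∁p⇒x∉p (from (oriented h) (α h , p , α-involutive h)))
    (λ h∉I → let x , x∈I , e = to (oriented h) (x∉p⇒x∈∁p h∉I)
             in subst (_∈ I) (trans (sym (α-involutive x)) (cong α e)) x∈I)

  spannedBy : Subset size → MarkedMap
  spannedBy S = record { map = M ; marked = S }

  visit : Subset size → ℕ → H
  visit S i = (θ (spannedBy S) ^ i) root

  Rule : Subset size → H → Set
  Rule S h = h ∈ S ⇔ h ∉ I

  -- Stated with visiting times, because `θ` is not yet known to be cyclic and its order may fail to
  -- be total.
  FollowsRule : Subset size → ℕ → Set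
  FollowsRule S i = (∀ {j} → j < i → visit S j ≢ α (visit S i)) → Rule S (visit S i)

  -- A visit depends on the set only through the half-edges visited strictly before it, so the bound
  -- is strict for the sides and weak for the visits.
  visit-local : ∀ {S T} n → (∀ {j} → j < n → visit S j ∈ S ⇔ visit S j ∈ T) → ∀ {i} → i ≤ n → visit S i ≡ visit T i
  visit-local         n       e {zero}  _   = refl
  visit-local {S} {T} (suc n) e {suc i} (s≤s i≤n) =
    trans (θ-commute (spannedBy S) (spannedBy T) {f = id} (λ _ → refl) (λ _ → refl) (e (s≤s i≤n)))
          (cong (θ (spannedBy T)) (visit-local n (e ∘ m<n⇒m<1+n) i≤n))

  module Override (S : Subset size) (h : H) where

    OnEdge : H → Set
    OnEdge x = x ≡ h ⊎ x ≡ α h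

    -- Both halves of the edge are decided by `h ∉ I`, which preserves stability.
    InNew : H → Set
    InNew x = (OnEdge x × h ∉ I) ⊎ (¬ OnEdge x × x ∈ S)

    onEdge? : ∀ x → Dec (OnEdge x)
    onEdge? x = (x ≟ h) ⊎-dec (x ≟ α h)

    inNew? : ∀ x → Dec (InNew x)
    inNew? x = (onEdge? x ×-dec ¬? (h ∈? I)) ⊎-dec (¬? (onEdge? x) ×-dec (x ∈? S))

    new : Subset size
    new = tabulate (does ∘ inNew?)

    onEdge-α : ∀ {x} → OnEdge x → OnEdge (α x)
    onEdge-α (inj₁ refl) = inj₂ refl
    onEdge-α (inj₂ refl) = inj₁ (α-involutive h)

    new-stable : Stable (spannedBy S) → Stable (spannedBy new)
    new-stable stable {x} p = from (∈-tabulate inNew?) (case to (∈-tabulate inNew?) p of λ where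
      (inj₁ (e , h∉I)) → inj₁ (onEdge-α e , h∉I)
      (inj₂ (¬e , q))  → inj₂ ((λ e → ¬e (subst OnEdge (α-involutive x) (onEdge-α e))) , stable q))

    new-outside : ∀ {x} → ¬ OnEdge x → x ∈ S ⇔ x ∈ new
    new-outside ¬e = mk⇔ (λ p → from (∈-tabulate inNew?) (inj₂ (¬e , p)))
      λ p → case to (∈-tabulate inNew?) p of λ where
        (inj₁ (e , _)) → contradiction e ¬e
        (inj₂ (_ , q)) → q

    new-rule : Rule new h
    new-rule = mk⇔
      (λ p → case to (∈-tabulate inNew?) p of λ where
        (inj₁ (_ , h∉I)) → h∉I
        (inj₂ (¬e , _))  → contradiction (inj₁ refl) ¬e)
      (λ h∉I → from (∈-tabulate inNew?) (inj₁ (inj₁ refl , h∉I)))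

  -- Visit `n` calls for a choice only when its edge has not been met before; changing `S` on that
  -- edge leaves the visits up to time `n` intact by `visit-local`.
  simulate : ∀ n → Σ[ S ∈ Subset size ] Stable (spannedBy S) × (∀ {i} → i < n → FollowsRule S i)
  simulate zero    = ⊥ , (λ p → contradiction p ∉⊥) , λ ()
  simulate (suc n) with simulate n
  ... | S , stable , rule with anyUpTo? (λ j → visit S j ≟ α (visit S n)) n | anyUpTo? (λ j → visit S j ≟ visit S n) n
  ...   | yes (j , j<n , e) | _ = S , stable , λ i<1+n → case m<1+n⇒m<n∨m≡n i<1+n of λ where
    (inj₁ i<n)  → rule i<n
    (inj₂ refl) → λ fresh → contradiction e (fresh j<n)
  -- A half-edge visited again obeys the rule because it did so at the earlier time, whose past is
  -- contained in the present one.
  ...   | no _ | yes (j , j<n , e) = S , stable , λ i<1+n → case m<1+n⇒m<n∨m≡n i<1+n of λ where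
    (inj₁ i<n)  → rule i<n
    (inj₂ refl) → λ fresh → subst (Rule S) e
      (rule j<n λ l<j e′ → fresh (<-trans l<j j<n) (trans e′ (cong α e)))
  ...   | no ¬opposite | no ¬same = new , new-stable stable , λ i<1+n → case m<1+n⇒m<n∨m≡n i<1+n of λ where
      (inj₁ i<n)  → old i<n
      (inj₂ refl) → λ _ → subst (Rule new) (same-visit ≤-refl) new-rule
    where
    open Override S (visit S n)
    offEdge : ∀ {j} → j < n → ¬ OnEdge (visit S j)
    offEdge j<n (inj₁ e) = ¬same (_ , j<n , e)
    offEdge j<n (inj₂ e) = ¬opposite (_ , j<n , e)
    same-visit : ∀ {i} → i ≤ n → visit S i ≡ visit new i
    same-visit = visit-local n (λ j<n → new-outside (offEdge j<n))
    old : ∀ {i} → i < n → FollowsRule new i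
    old {i} i<n fresh = subst (Rule new) eqᵢ
      (rule i<n (λ j<i e → fresh j<i (trans (sym (same-visit (<⇒≤ (<-trans j<i i<n)))) (trans e (cong α eqᵢ))))
        ⇔-∘ ⇔-sym (new-outside (offEdge i<n)))
      where
      eqᵢ : visit S i ≡ visit new i
      eqᵢ = same-visit (<⇒≤ i<n)

  S : Subset size
  S = proj₁ (simulate size)

  A : MarkedMap
  A = spannedBy S

  stable : Stable A
  stable = proj₁ (proj₂ (simulate size))

  followsRule : ∀ {i} → i < size → FollowsRule S i
  followsRule = proj₂ (proj₂ (simulate size))

  -- Half-edges visited from the root in the reconstructed map

  Appears? : ∀ x → Dec (Appears A x)
  Appears? x = anyUpTo? (λ i → visit S i ≟ x) size

  appears-θ⁻ : ∀ {x} → Appears A (θ A x) → Appears A x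
  appears-θ⁻ {x} (i , _ , e) =
    let c , e′ = ^-return (θ A) (θ-injective A stable) 1 x
        k , k<n , e″ = ^-reduce (θ A) (θ-injective A stable) (c + i) root
    in k , k<n , trans e″ (trans (^-+ (θ A) c i root) (trans (cong (θ A ^ c) e) e′))

  appears-rule : ∀ {x} → Appears A x → ¬ Appears A (α x) → Rule S x
  appears-rule (i , i<n , refl) ¬αx = followsRule i<n λ j<i e → ¬αx (_ , <-trans j<i i<n , e)

  -- The `θ A`-preimage of `σ g` is `α g` if `g ∈ S` and `g` otherwise. Were it the only visited
  -- half of its edge, the rule would, as `g ∉ I` and `α g ∈ I`, put the edge on the other side of
  -- `S`.
  appears-edge : ∀ {g} → g ∉ I → Appears A (σ g) → Appears A g × Appears A (α g)
  appears-edge {g} g∉I ap = case g ∈? S of λ where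
    (yes g∈S) →
      let αg = appears-θ⁻ (subst (Appears A) (sym (trans (θ-∈ A (stable g∈S)) (cong σ (α-involutive g)))) ap)
      in decidable-stable (Appears? g) (λ ¬g →
           to (appears-rule αg (¬g ∘ subst (Appears A) (α-involutive g))) (stable g∈S) (from α∈I⇔∉I g∉I)) , αg
    (no g∉S) →
      let g′ = appears-θ⁻ (subst (Appears A) (sym (θ-∉ A g∉S)) ap)
      in g′ , decidable-stable (Appears? (α g)) (λ ¬αg → g∉S (from (appears-rule g′ ¬αg) g∉I))

  appears-σ^ : ∀ q {g} → (∀ p → p < suc q → (σ ^ p) g ∈ O B) →
               Appears A ((σ ^ suc q) g) → Appears A g × Appears A (α g)
  appears-σ^ zero    out ap = appears-edge (x∈∁p⇒x∉p (out 0 (s≤s z≤n))) ap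
  appears-σ^ (suc q) out ap =
    appears-σ^ q (λ p p<1+q → out p (m<n⇒m<1+n p<1+q)) (proj₁ (appears-edge (x∈∁p⇒x∉p (out (suc q) ≤-refl)) ap))

  appears-leftStep : ∀ {h′ h} → LeftStep B h′ h → Appears A h′ → Appears A h × Appears A (α h)
  appears-leftStep {h = h} (_ , suc q , _ , refl , out) ap =
    let αh , ααh = appears-σ^ q out ap in subst (Appears A) (α-involutive h) ααh , αh

  appears-leftPath : ∀ {h′ h} → TransClosure (LeftStep B) h′ h → Appears A h′ → Appears A h × Appears A (α h)
  appears-leftPath [ s ]    ap = appears-leftStep s ap
  appears-leftPath (s ∷ ss) ap = appears-leftPath ss (proj₁ (appears-leftStep s ap))

  appears-root : Appears A root
  appears-root = ^-reduce (θ A) (θ-injective A stable) 0 root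

  cyclic : IsCyclic A
  cyclic = record { stable = stable ; appears = λ x → case x ∈? I of λ where
    (yes x∈I) → proj₁ (appears-leftPath (leftConnected x∈I) appears-root)
    -- The opposite of `x` lies in `I`, and a left-path to it visits both halves of its edge.
    (no  x∉I) → subst (Appears A) (α-involutive x)
                  (proj₂ (appears-leftPath (leftConnected (from α∈I⇔∉I x∉I)) appears-root)) }

  open Cyclic A cyclic using (pos; pos<size; θ^pos; pos-unique; ≺⇔pos<; firstVisitRule⇒Δ)

  firstVisitRule : FirstVisitRule A I
  firstVisitRule {h} h≺αh = subst (Rule S) (θ^pos h) (followsRule (pos<size h) λ j<i e →
    <-asym (to ≺⇔pos< h≺αh) (subst (_< pos h) (pos-unique (<-trans j<i (pos<size h)) (trans e (cong α (θ^pos h)))) j<i))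

  ΔA≅B : Δ A ≅ B
  ΔA≅B = record
    { relabel     = ↔-id _
    ; σ-compat    = λ _ → refl
    ; α-compat    = λ _ → refl
    ; root-compat = refl
    ; set-compat  = λ _ → firstVisitRule⇒Δ firstVisitRule α∈I⇔∉I ⇔-∘ ∈Δ A
    }

mainTheorem2 : Σ[ b ∈ Bijection CoveredMap LeftConnectedOrientedMap ]
    (∀ C → proj₁ (Bijection.to b C) ≡ Δ (proj₁ C))
mainTheorem2 = bijection , λ _ → refl
  where
  bijection : Bijection CoveredMap LeftConnectedOrientedMap
  bijection = record
    { to        = λ (A , cov) → Δ A , Δ-leftConnectedOriented cov
    ; cong      = Δ-cong
    ; bijective = (λ {(A , covA)} {(B , covB)} → Δ-reflects-≅ (covered⇒cyclic A covA) (covered⇒cyclic B covB))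
                , λ (B , lco) → let open Reconstruct B lco in
                    -- Surjectivity between setoids asks that every `A′ ≅ A` also be sent to a
                    -- relabelling of `B`.
                    (A , cyclic⇒covered A cyclic) , λ A′≅A → ≅-trans (Δ-cong A′≅A) ΔA≅B
    }
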